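{- Let $G=(V,E)$ be a graph and $\mathfrak d_{|S_v}(V)=\bigcup_{v\in V}\mathfrak d_{|S_v}$. Then $\mathfrak d_{|S_v}(V)^*=\delta(G)^*$.
   Context: All graphs are finite, simple and undirected. For $G=(V,E)$ and $v\in V$, $E_v$ is the set of edges incident to $v$. For two distinct adjacent edges $e=(v,u)$, $f=(v,w)$, a square spanned by $e$ and $f$ is a $4$-cycle $v,u,x,w,v$ with $x\notin\{v,u,w\}$; it is chordless if neither $(u,w)$ nor $(v,x)$ is an edge. In a chordless square $v,u,x,w$, $(x,w)$ is opposite to $(v,u)$ and $(x,u)$ is opposite to $(v,w)$ (and vice versa). The relation $\delta(G)$ on $E$: $(e,f)\in\delta(G)$ iff (i) $e,f$ are distinct adjacent edges and it is not the case that $e$ and $f$ span exactly one square and that square is chordless; or (ii) $e,f$ are opposite edges of a chordless square; or (iii) $e=f$. For a relation $R$ on $E$, $R^*$ is its transitive closure, the finest equivalence relation on $E$ containing $R$. Define $\mathfrak d_v=((E_v\times E)\cup(E\times E_v))\cap\delta(G)$ and $\mathfrak d_v^*$ the finest equivalence relation on $E$ containing $\mathfrak d_v$. Let $F_v\subseteq E\setminus E_v$ be the set of edges that are the edges not incident to $v$ of some chordless square spanned by two edges $e,e'\in E_v$ with $(e,e')\notin\mathfrak d_v^*$. The partial star product $S_v$ is the subgraph of $G$ with edge set $E_v\cup F_v$ and vertex set the endpoints of these edges. $\mathfrak d_{|S_v}=\{(e,f)\in\mathfrak d_v^*: e,f\in E(S_v)\}$. -}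

module Defs where

open import Level using (0ℓ)
open import Data.Nat using (ℕ)
open import Data.Fin using (Fin; _<_)
open import Data.Product using (Σ; ∃; ∃-syntax; ∃!; _×_; _,_)
open import Data.Sum using (_⊎_)
open import Relation.Nullary using (¬_)
open import Relation.Unary using (Pred; _∈_; _∉_)
open import Relation.Binary using (Rel; Symmetric; Irreflexive; Decidable)
open import Relation.Binary.PropositionalEquality using (_≡_; _≢_)
open import Relation.Binary.Construct.Closure.Equivalence using (EqClosure)

record Graph : Set₁ where
  field
    order : ℕ

  V : Set
  V = Fin order

  field
    Adj    : Rel V 0ℓ
    sym    : Symmetric Adj
    irrefl : Irreflexive _≡_ Adj
    adj?   : Decidable Adj

module _ (G : Graph) where
  open Graph G

  -- An undirected edge is stored once, with its smaller endpoint first. The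
  -- proof fields are irrelevant, so edges with the same endpoints are equal
  -- in the sense of _≡_.
  record Edge : Set where
    constructor mkEdge
    field
      lo hi  : V
      .lo<hi : lo < hi
      .adj   : Adj lo hi

  -- Joins e u v: e is the undirected edge (u,v), in either order.
  Joins : Edge → V → V → Set
  Joins e u v = (lo ≡ u × hi ≡ v) ⊎ (lo ≡ v × hi ≡ u)
    where open Edge e

  -- E v is the set E_v of edges incident to v.
  E : V → Pred Edge 0ℓ
  E v e = (Edge.lo e ≡ v) ⊎ (Edge.hi e ≡ v)

  -- The 4-cycle v,u,x,w,v. Consecutive vertices are distinct because Adj is
  -- irreflexive.
  record Square (v u x w : V) : Set where
    field
      v~u : Adj v u
      u~x : Adj u x
      x~w : Adj x w
      w~v : Adj w v
      u≢w : u ≢ w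
      v≢x : v ≢ x

  Chordless : (v u x w : V) → Set
  Chordless v u x w = ¬ Adj u w × ¬ Adj v x

  ChordlessSquare : (v u x w : V) → Set
  ChordlessSquare v u x w = Square v u x w × Chordless v u x w

  -- (v,u) and (v,w) span exactly one square and that square is chordless.
  -- Such a square is determined by its fourth vertex x.
  SpanUniqueChordless : (v u w : V) → Set
  SpanUniqueChordless v u w =
    Σ (∃! _≡_ λ x → Square v u x w) λ (x , _) → Chordless v u x w

  -- The other pair of opposite edges, (x,u) and (v,w), is covered by
  -- `opposite` through the rotated square u,x,w,v.
  data δ (e f : Edge) : Set where
    adjacent : ∀ {v u w} → Joins e v u → Joins f v w → e ≢ f →
               ¬ SpanUniqueChordless v u w → δ e f
    opposite : ∀ {v u x w} → ChordlessSquare v u x w →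
               Joins e v u → Joins f x w → δ e f
    equal    : e ≡ f → δ e f

  𝔡 : V → Rel Edge 0ℓ
  𝔡 v e f = (e ∈ E v ⊎ f ∈ E v) × δ e f

  𝔡* : V → Rel Edge 0ℓ
  𝔡* v = EqClosure (𝔡 v)

  -- Two distinct edges incident to v have only v in common, so a square
  -- spanned by them has the form v,u,x,w and its edges missing v are (u,x)
  -- and (x,w).
  F : V → Pred Edge 0ℓ
  F v g = g ∉ E v ×
    (∃[ e ] ∃[ e′ ] e ∈ E v × e′ ∈ E v × ¬ 𝔡* v e e′ ×
     ∃[ u ] ∃[ x ] ∃[ w ]
       ChordlessSquare v u x w × Joins e v u × Joins e′ v w ×
       (Joins g u x ⊎ Joins g x w))

  record Subgraph : Set₁ where
    field
      vertices  : Pred V 0ℓ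
      edges     : Pred Edge 0ℓ
      endpoints : ∀ {e u} → e ∈ edges → e ∈ E u → u ∈ vertices

  -- The partial star product S_v.
  S : V → Subgraph
  S v = record
    { vertices  = λ u → ∃[ e ] (e ∈ E v ⊎ e ∈ F v) × e ∈ E u
    ; edges     = λ e → e ∈ E v ⊎ e ∈ F v
    ; endpoints = λ {e} e∈S e∈Eu → e , e∈S , e∈Eu
    }

  𝔡|S : V → Rel Edge 0ℓ
  𝔡|S v e f = 𝔡* v e f × e ∈ Subgraph.edges (S v) × f ∈ Subgraph.edges (S v)

  -- The union of the relations 𝔡|S v over all vertices v.
  𝔡|S[V] : Rel Edge 0ℓ
  𝔡|S[V] e f = ∃[ v ] 𝔡|S v e f

{-# OPTIONS --safe #-}
-- Only opposite edges e = (v,u) and f = (x,w) of a chordless square v,u,x,w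
-- need an argument. Let g = (u,x) be an edge of the square joining them. If e and
-- g are not 𝔡*-related at u, then f ∈ F_u and S_u relates e and f; likewise for
-- f and g at x. Otherwise S_u relates e and g, and S_x relates g and f.
--
-- This case distinction is constructive because 𝔡* is decidable, by Warshall's
-- algorithm over the finitely many edges.
module Submission where

open import Defs
open import Level using (Level; _⊔_)
open import Data.Empty using (⊥-elim-irr)
open import Data.Fin.Properties using (_≟_; _<?_; <-cmp; any?; all?)
open import Data.List using (List; []; _∷_; concatMap; allFin)
open import Data.List.Membership.Propositional using (_∈_; lose)
open import Data.List.Membership.Propositional.Properties using (∈-concatMap⁺; ∈-allFin)
open import Data.List.Relation.Unary.Any using (here; there)
open import Data.Product using (_×_; _,_; proj₁; proj₂; ∃-syntax)
open import Data.Sum using (_⊎_; inj₁; inj₂; [_,_])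
open import Function using (_∘_; id)
open import Relation.Binary using (Rel; _⇔_; _⇒_; Decidable; DecidableEquality; tri<; tri≈; tri>)
open import Relation.Binary.Construct.Closure.Equivalence as Eq using (EqClosure)
open import Relation.Binary.Construct.Closure.Reflexive using (ReflClosure; refl) renaming ([_] to step)
import Relation.Binary.Construct.Closure.Reflexive.Properties as Refl
open import Relation.Binary.Construct.Closure.ReflexiveTransitive using (Star; ε; _◅_; _◅◅_; return)
open import Relation.Binary.Construct.Closure.Symmetric using (SymClosure; fwd; bwd)
open import Relation.Binary.PropositionalEquality using (_≢_; refl; ≢-sym)
open import Relation.Nullary using (Dec; yes; no; ¬?; contradiction)
open import Relation.Nullary.Decidable using (map′; _×-dec_; _⊎-dec_; _→-dec_)
import Relation.Unary as U

module _ {a ℓ : Level} {A : Set a} (R : Rel A ℓ) where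

  -- R-paths whose intermediate vertices lie in the list.
  Through : List A → Rel A (a ⊔ ℓ)
  Through []       y z = ReflClosure R y z
  Through (x ∷ xs) y z = Through xs y z ⊎ (Through xs y x × Through xs x z)

  through? : DecidableEquality A → Decidable R → ∀ xs → Decidable (Through xs)
  through? _≟ᴬ_ R? []       y z = Refl.dec _≟ᴬ_ R? y z
  through? _≟ᴬ_ R? (x ∷ xs) y z = rec y z ⊎-dec (rec y x ×-dec rec x z)
    where rec = through? _≟ᴬ_ R? xs

  through⇒star : ∀ xs → Through xs ⇒ Star R
  through⇒star []       (step yRz)       = return yRz
  through⇒star []       refl           = ε
  through⇒star (x ∷ xs) (inj₁ p)       = through⇒star xs p
  through⇒star (x ∷ xs) (inj₂ (p , q)) = through⇒star xs p ◅◅ through⇒star xs q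

  refl-closure⇒through : ∀ xs → ReflClosure R ⇒ Through xs
  refl-closure⇒through []       r = r
  refl-closure⇒through (x ∷ xs) r = inj₁ (refl-closure⇒through xs r)

  -- Concatenation is possible only at a vertex of the list. If it is the head, loops at it are cut
  -- off both paths and the remnants form the right summand. Otherwise induct on the list; when both
  -- paths pass through the head, the closed walk from the head via `y` back to the head is dropped.
  through-trans : ∀ {xs x y z} → y ∈ xs → Through xs x y → Through xs y z → Through xs x z
  through-trans (here refl) p q = inj₂ ([ id , proj₁ ] p , [ id , proj₂ ] q)
  through-trans (there y∈xs) (inj₁ p)       (inj₁ q)       = inj₁ (through-trans y∈xs p q)
  through-trans (there y∈xs) (inj₁ p)       (inj₂ (q , r)) = inj₂ (through-trans y∈xs p q , r)
  through-trans (there y∈xs) (inj₂ (p , q)) (inj₁ r)       = inj₂ (p , through-trans y∈xs q r)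
  through-trans (there y∈xs) (inj₂ (p , _)) (inj₂ (_ , r)) = inj₂ (p , r)

  -- A complete list makes every vertex of a path an admissible point of concatenation.
  star⇒through : ∀ {xs} → (∀ x → x ∈ xs) → Star R ⇒ Through xs
  star⇒through {xs} _   ε        = refl-closure⇒through xs refl
  star⇒through {xs} all (r ◅ rs) =
    through-trans (all _) (refl-closure⇒through xs (step r)) (star⇒through all rs)

  star? : DecidableEquality A → ∀ {xs} → (∀ x → x ∈ xs) → Decidable R → Decidable (Star R)
  star? _≟ᴬ_ {xs} all R? y z =
    map′ (through⇒star xs) (star⇒through all) (through? _≟ᴬ_ R? xs y z)

symClosure? : ∀ {a ℓ} {A : Set a} {R : Rel A ℓ} → Decidable R → Decidable (SymClosure R)
symClosure? R? x y =
  map′ [ fwd , bwd ] (λ { (fwd r) → inj₁ r ; (bwd r) → inj₂ r }) (R? x y ⊎-dec R? y x)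

module _ (G : Graph) where
  open Graph G renaming (sym to adj-sym)

  infix 4 _≟ᴱ_

  _≟ᴱ_ : DecidableEquality (Edge G)
  mkEdge l h _ _ ≟ᴱ mkEdge l′ h′ _ _ =
    map′ (λ { (refl , refl) → refl }) (λ { refl → refl , refl }) (l ≟ l′ ×-dec h ≟ h′)

  edgesBetween : V → V → List (Edge G)
  edgesBetween i j with i <? j ×-dec adj? i j
  ... | yes (i<j , i~j) = mkEdge i j i<j i~j ∷ []
  ... | no _            = []

  ∈-edgesBetween : ∀ e → e ∈ edgesBetween (Edge.lo e) (Edge.hi e)
  ∈-edgesBetween (mkEdge i j i<j i~j) with i <? j ×-dec adj? i j
  -- The proof fields of an edge are irrelevant: the listed edge equals the given one by `refl`, and
  -- in the other case the fields may serve only to derive a contradiction.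
  ... | yes _ = here refl
  ... | no ¬p = ⊥-elim-irr (¬p (i<j , i~j))

  allEdges : List (Edge G)
  allEdges = concatMap (λ i → concatMap (edgesBetween i) (allFin order)) (allFin order)

  ∈-allEdges : ∀ e → e ∈ allEdges
  ∈-allEdges e =
    ∈-concatMap⁺ _ (lose (∈-allFin (Edge.lo e))
      (∈-concatMap⁺ (edgesBetween (Edge.lo e)) (lose (∈-allFin (Edge.hi e)) (∈-edgesBetween e))))

  joins? : ∀ e u v → Dec (Joins G e u v)
  joins? (mkEdge l h _ _) u v = (l ≟ u ×-dec h ≟ v) ⊎-dec (l ≟ v ×-dec h ≟ u)

  incident? : ∀ v → U.Decidable (E G v)
  incident? v (mkEdge l h _ _) = l ≟ v ⊎-dec h ≟ v

  square? : ∀ v u x w → Dec (Square G v u x w)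
  square? v u x w = map′
    (λ (v~u , u~x , x~w , w~v , u≢w , v≢x) → record
      { v~u = v~u ; u~x = u~x ; x~w = x~w ; w~v = w~v ; u≢w = u≢w ; v≢x = v≢x })
    (λ s → let open Square s in v~u , u~x , x~w , w~v , u≢w , v≢x)
    (adj? v u ×-dec adj? u x ×-dec adj? x w ×-dec adj? w v ×-dec ¬? (u ≟ w) ×-dec ¬? (v ≟ x))

  chordless? : ∀ v u x w → Dec (Chordless G v u x w)
  chordless? v u x w = ¬? (adj? u w) ×-dec ¬? (adj? v x)

  -- Gathering uniqueness and chordlessness under one existential over the fourth vertex reduces the
  -- question to a search over finitely many vertices.
  spanUniqueChordless? : ∀ v u w → Dec (SpanUniqueChordless G v u w)
  spanUniqueChordless? v u w = map′
    (λ (x , s , unique , c) → (x , s , λ {y} → unique y) , c)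
    (λ ((x , s , unique) , c) → x , s , (λ y → unique {y}) , c)
    (any? λ x → square? v u x w
          ×-dec all? (λ y → square? v u y w →-dec x ≟ y)
          ×-dec chordless? v u x w)

  δ? : Decidable (δ G)
  δ? e f = map′
    [ (λ (_ , _ , _ , p , q , e≢f , ¬s) → adjacent p q e≢f ¬s)
    , [ (λ (_ , _ , _ , _ , s , p , q) → opposite s p q) , equal ] ]
    (λ { (adjacent p q e≢f ¬s) → inj₁ (_ , _ , _ , p , q , e≢f , ¬s)
       ; (opposite s p q)      → inj₂ (inj₁ (_ , _ , _ , _ , s , p , q))
       ; (equal e≡f)           → inj₂ (inj₂ e≡f) })
    ((any? λ v → any? λ u → any? λ w →
        joins? e v u ×-dec joins? f v w ×-dec ¬? (e ≟ᴱ f) ×-dec ¬? (spanUniqueChordless? v u w))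
     ⊎-dec
     (any? λ v → any? λ u → any? λ x → any? λ w →
        (square? v u x w ×-dec chordless? v u x w) ×-dec joins? e v u ×-dec joins? f x w)
     ⊎-dec
     (e ≟ᴱ f))

  𝔡? : ∀ v → Decidable (𝔡 G v)
  𝔡? v e f = (incident? v e ⊎-dec incident? v f) ×-dec δ? e f

  𝔡*? : ∀ v → Decidable (𝔡* G v)
  𝔡*? v = star? _ _≟ᴱ_ ∈-allEdges (symClosure? (𝔡? v))

  joins-swap : ∀ e {u v} → Joins G e u v → Joins G e v u
  joins-swap _ = [ inj₂ , inj₁ ]

  joins⇒incident : ∀ e {u v} → Joins G e u v → e U.∈ E G u
  joins⇒incident _ = [ inj₁ ∘ proj₁ , inj₂ ∘ proj₂ ]

  joins⇒nonincident : ∀ e {u v w} → Joins G e u v → u ≢ w → v ≢ w → e U.∉ E G w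
  joins⇒nonincident _ (inj₁ (refl , refl)) u≢w v≢w = [ u≢w , v≢w ]
  joins⇒nonincident _ (inj₂ (refl , refl)) u≢w v≢w = [ v≢w , u≢w ]

  edge : ∀ {u v} → Adj u v → ∃[ e ] Joins G e u v
  edge {u} {v} u~v with <-cmp u v
  ... | tri< u<v _ _ = mkEdge u v u<v u~v , inj₁ (refl , refl)
  ... | tri≈ _ u≡v _ = contradiction u~v (irrefl u≡v)
  ... | tri> _ _ v<u = mkEdge v u v<u (adj-sym u~v) , inj₂ (refl , refl)

  adj⇒≢ : ∀ {u v} → Adj u v → u ≢ v
  adj⇒≢ u~v u≡v = irrefl u≡v u~v

  -- Together with `reflect` this yields every reading of a 4-cycle, so a result about its first
  -- corner applies at each corner in both directions. A rotation exchanges the diagonals, hence the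
  -- two chord conditions.
  rotate : ∀ {v u x w} → ChordlessSquare G v u x w → ChordlessSquare G u x w v
  rotate (s , ¬u~w , ¬v~x) = record
    { v~u = u~x ; u~x = x~w ; x~w = w~v ; w~v = v~u ; u≢w = ≢-sym v≢x ; v≢x = u≢w }
    , ¬v~x ∘ adj-sym , ¬u~w
    where open Square s

  reflect : ∀ {v u x w} → ChordlessSquare G v u x w → ChordlessSquare G v w x u
  reflect (s , ¬u~w , ¬v~x) = record
    { v~u = adj-sym w~v ; u~x = adj-sym x~w ; x~w = adj-sym u~x ; w~v = adj-sym v~u
    ; u≢w = ≢-sym u≢w ; v≢x = v≢x }
    , ¬u~w ∘ adj-sym , ¬v~x
    where open Square s

  -- Being opposite with `e` at `v`, the edges `e` and `f` are related by `𝔡 G v` in any case; only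
  -- membership of `f` in `S_v` is at stake. If `e` and `g` are not related, the square itself
  -- witnesses that `f` lies in `F_v`.
  star-relates-adjacent-or-opposite :
    ∀ e f g {v u x w} → ChordlessSquare G v u x w →
    Joins G e v u → Joins G g v w → Joins G f x w → 𝔡|S G v e g ⊎ 𝔡|S G v e f
  star-relates-adjacent-or-opposite e f g {v} sq@(s , _) e-vu g-vw f-xw
    with 𝔡*? v e g
  ... | yes e~g = inj₁ (e~g , inj₁ e∈ , inj₁ g∈)
    where e∈ = joins⇒incident e e-vu ; g∈ = joins⇒incident g g-vw
  ... | no  e≁g = inj₂
    ( Eq.return (inj₁ e∈ , eδf)
    , inj₁ e∈
    -- The edge `f` misses `v` because one of its ends is the corner diagonal to `v` and the other
    -- is a neighbour of `v`.
    , inj₂ ( joins⇒nonincident f f-xw (≢-sym v≢x) (adj⇒≢ w~v)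
           , e , g , e∈ , joins⇒incident g g-vw , e≁g
           , _ , _ , _ , sq , e-vu , g-vw , inj₂ f-xw ) )
    where
    open Square s
    e∈ = joins⇒incident e e-vu
    eδf : δ G e f
    eδf = opposite sq e-vu f-xw

  opposite⇒𝔡|S : ∀ e f {v u x w} → ChordlessSquare G v u x w →
                 Joins G e v u → Joins G f x w → EqClosure (𝔡|S[V] G) e f
  opposite⇒𝔡|S e f sq e-vu f-xw
    with g , g-ux ← edge (Square.u~x (proj₁ sq))
    -- The same square is read from the two ends of `g`: as u,x,w,v reversed to u,v,w,x, and as
    -- x,w,v,u.
    with star-relates-adjacent-or-opposite e f g (reflect (rotate sq))
           (joins-swap e e-vu) g-ux (joins-swap f f-xw)
       | star-relates-adjacent-or-opposite f e g (rotate (rotate sq))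
           f-xw (joins-swap g g-ux) e-vu
  ... | inj₂ e~f | _        = Eq.return (_ , e~f)
  ... | inj₁ _   | inj₂ f~e = Eq.symmetric _ (Eq.return (_ , f~e))
  ... | inj₁ e~g | inj₁ f~g = Eq.return (_ , e~g) ◅◅ Eq.symmetric _ (Eq.return (_ , f~g))

  δ⇒𝔡|S : δ G ⇒ EqClosure (𝔡|S[V] G)
  -- Both edges lie in `E_v` for their common endpoint `v`, so `d` is a single generator there.
  δ⇒𝔡|S {e} {f} d@(adjacent e-vu f-vw _ _) =
    Eq.return (_ , Eq.return (inj₁ e∈ , d) , inj₁ e∈ , inj₁ (joins⇒incident f f-vw))
    where e∈ = joins⇒incident e e-vu
  δ⇒𝔡|S {e} {f} (opposite sq e-vu f-xw) = opposite⇒𝔡|S e f sq e-vu f-xw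
  δ⇒𝔡|S (equal refl) = ε

theorem3p9 : (G : Graph) → EqClosure (𝔡|S[V] G) ⇔ EqClosure (δ G)
-- Forward, each generator of `𝔡* G v` is a pair in `δ G` with an incidence condition, which `proj₂`
-- forgets.
theorem3p9 G = (λ (v , e~f , _) → Eq.map proj₂ e~f) Eq.⋆ , δ⇒𝔡|S G Eq.⋆
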